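{- Let $L$ be a Lipschitz language, let $\mu$ be an ultracharge on a nonempty set $I$, let $(M_i)_{i\in I}$ be $L$-structures, and let $M=\prod_\mu M_i$ be their ultramean. Then for every affine $L$-formula $\phi(x_1,\dots,x_n)$ and all $[a^1_i],\dots,[a^n_i]\in M$, $$\phi^{M}([a^{1}_{i}],\ldots,[a^{n}_{i}])=\int\phi^{M_{i}}(a^{1}_{i},\ldots,a^{n}_{i})\,d\mu .$$
   Context: A Lipschitz language $L$ consists of constant symbols, function symbols and relation symbols; each function symbol $F$ (resp. relation symbol $R$) has an arity $n\ge 1$ and a Lipschitz constant $\lambda_F\ge0$ (resp. $\lambda_R\ge 0$); $L$ contains a binary relation symbol $d$ with $\lambda_d=1$. An $L$-structure is a complete metric space $(M,d)$ of diameter at most $1$ (with $d$ interpreting the symbol $d$) together with elements $c^M$ for constants, maps $F^M:M^n\to M$ with $d(F^M(\bar a),F^M(\bar b))\le\lambda_F d(\bar a,\bar b)$ and maps $R^M:M^n\to[0,1]$ with $R^M(\bar a)-R^M(\bar b)\le\lambda_R d(\bar a,\bar b)$, where $d(\bar a,\bar b)=\sum_i d(a_i,b_i)$ on $M^n$. Affine formulas are built from the atomic formulas $1$, $d(t_1,t_2)$, $R(t_1,\dots,t_n)$ ($t_j$ terms) by $\phi+\psi$, $r\phi$ ($r\in\mathbb R$), $\sup_x\phi$, $\inf_x\phi$; their values $\phi^M(\bar a)\in\mathbb R$ are defined in the evident way (sup/inf taken over $M$); the same definition of values applies to structures whose metric is only a pseudometric or not complete. An ultracharge on $I$ is a finitely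 additive probability measure on the full power set of $I$; every bounded real function on $I$ is integrable with respect to it. The ultramean $M=\prod_\mu M_i$: on $\prod_i M_i$ put the pseudometric $d((a_i),(b_i))=\int d_i(a_i,b_i)\,d\mu$, let $[a_i]$ denote the class of $(a_i)$ modulo distance $0$, let $M$ be the set of classes with the induced metric, and set $c^M=[c^{M_i}]$, $F^M([a^1_i],\dots,[a^n_i])=[F^{M_i}(a^1_i,\dots,a^n_i)]$, $R^M([a^1_i],\dots,[a^n_i])=\int R^{M_i}(a^1_i,\dots,a^n_i)\,d\mu$ (these are well defined; $M$ need not be metrically complete). -}

module Defs where

open import Algebra.Bundles using (RawMonoid)
import Algebra.Definitions.RawMonoid as RawMonoidDefs
open import Algebra.Structures using (IsCommutativeRing)
open import Axiom.ExcludedMiddle using (ExcludedMiddle)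
open import Data.Fin.Base using (Fin)
open import Data.Nat.Base as ℕ using (ℕ; suc)
open import Data.Product.Base using (∃; _×_; _,_)
open import Data.Unit.Polymorphic.Base using (⊤)
open import Data.Vec.Base using (Vec; []; _∷_; lookup; map)
open import Function.Metric.Structures using (IsGeneralMetric)
open import Level using (Level; Lift) renaming (suc to lsuc)
open import Relation.Binary.Core using () renaming (Rel to BinRel)
import Relation.Binary.Construct.NonStrictToStrict as ToStrict
open import Relation.Binary.PropositionalEquality.Core using (_≡_)
open import Relation.Binary.Structures using (IsTotalOrder)
open import Relation.Nullary using (¬_; yes; no)
open import Relation.Unary using (Pred; Satisfiable; _∪_; _⊥_; _≐_)

-- The standard library has no real numbers.  They enter as an arbitrary
-- Dedekind-complete ordered field, which classically is ℝ up to unique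
-- isomorphism.

record CompleteOrderedField (ℓ : Level) : Set (lsuc ℓ) where
  infix  4 _≈_ _≤_
  infixl 6 _+_
  infixl 7 _*_
  infix  8 -_
  field
    Carrier : Set ℓ
    _≈_     : BinRel Carrier ℓ
    _≤_     : BinRel Carrier ℓ
    _+_     : Carrier → Carrier → Carrier
    _*_     : Carrier → Carrier → Carrier
    -_      : Carrier → Carrier
    0#      : Carrier
    1#      : Carrier

  IsUpperBound : Pred Carrier ℓ → Pred Carrier ℓ
  IsUpperBound S u = ∀ x → S x → x ≤ u

  IsLowerBound : Pred Carrier ℓ → Pred Carrier ℓ
  IsLowerBound S l = ∀ x → S x → l ≤ x

  IsSupremum : Pred Carrier ℓ → Pred Carrier ℓ
  IsSupremum S s = IsUpperBound S s × (∀ u → IsUpperBound S u → s ≤ u)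

  IsInfimum : Pred Carrier ℓ → Pred Carrier ℓ
  IsInfimum S s = IsLowerBound S s × (∀ l → IsLowerBound S l → l ≤ s)

  field
    isCommutativeRing : IsCommutativeRing _≈_ _+_ _*_ -_ 0# 1#
    0≉1               : ¬ (0# ≈ 1#)
    inverse           : ∀ x → ¬ (x ≈ 0#) → ∃ λ y → x * y ≈ 1#
    isTotalOrder      : IsTotalOrder _≈_ _≤_
    +-monoˡ-≤         : ∀ z {x y} → x ≤ y → x + z ≤ y + z
    *-nonNeg          : ∀ {x y} → 0# ≤ x → 0# ≤ y → 0# ≤ x * y
    complete          : (S : Pred Carrier ℓ) → Satisfiable S →
                        ∃ (IsUpperBound S) → ∃ (IsSupremum S)

  open ToStrict _≈_ _≤_ public using (_<_)

  +-rawMonoid : RawMonoid ℓ ℓ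
  +-rawMonoid = record { Carrier = Carrier ; _≈_ = _≈_ ; _∙_ = _+_ ; ε = 0# }

  open RawMonoidDefs +-rawMonoid public using (sum)

-- Excluded middle is a hypothesis because suprema, infima and integrals are
-- not computable; it is what turns them into functions.

module AffineLogic {ℓ : Level} (em : ExcludedMiddle ℓ)
                   (𝓡 : CompleteOrderedField ℓ) where

  open CompleteOrderedField 𝓡 renaming (Carrier to ℝ)

  -- Definite description, with the value 0 if nothing satisfies P.  It is
  -- used only for P that determine their argument up to _≈_.

  the : Pred ℝ ℓ → ℝ
  the P with em {∃ P}
  ... | yes (x , _) = x
  ... | no  _       = 0#

  range : {A : Set ℓ} → (A → ℝ) → Pred ℝ ℓ
  range f r = ∃ λ a → r ≈ f a

  ⨆ ⨅ : {A : Set ℓ} → (A → ℝ) → ℝ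
  ⨆ f = the (IsSupremum (range f))
  ⨅ f = the (IsInfimum (range f))

  record Ultracharge (I : Set ℓ) : Set (lsuc ℓ) where
    field
      measure     : Pred I ℓ → ℝ
      cong        : ∀ {A B} → A ≐ B → measure A ≈ measure B
      nonNegative : ∀ A → 0# ≤ measure A
      total       : measure (λ _ → ⊤) ≈ 1#
      additive    : ∀ {A B} → A ⊥ B →
                    measure (A ∪ B) ≈ measure A + measure B

  -- The simple function Σₖ (coeff k) · 1_{cell = k}.

  record Simple (I : Set ℓ) : Set ℓ where
    field
      {size} : ℕ
      cell   : I → Fin size
      coeff  : Fin size → ℝ

    at : I → ℝ
    at i = coeff (cell i)

  module _ {I : Set ℓ} (μ : Ultracharge I) where
    open Ultracharge μ
    open Simple

    ∫-simple : Simple I → ℝ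
    ∫-simple s = sum λ k → coeff s k * measure (λ i → Lift ℓ (cell s i ≡ k))

    LowerSum UpperSum : (I → ℝ) → Pred ℝ ℓ
    LowerSum f r = ∃ λ s → (∀ i → at s i ≤ f i) × r ≈ ∫-simple s
    UpperSum f r = ∃ λ s → (∀ i → f i ≤ at s i) × r ≈ ∫-simple s

    -- f is integrable with integral r: its lower and upper integrals both
    -- exist and equal r.

    IsIntegral : (I → ℝ) → Pred ℝ ℓ
    IsIntegral f r = IsSupremum (LowerSum f) r × IsInfimum (UpperSum f) r

    ∫ : (I → ℝ) → ℝ
    ∫ f = the (IsIntegral f)

  -- Fun n and Rel n are the function and relation symbols of arity n.

  record Language : Set (lsuc ℓ) where
    field
      Const     : Set ℓ
      Fun       : ℕ → Set ℓ
      Rel       : ℕ → Set ℓ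
      Fun-arity : ∀ {n} → Fun n → 1 ℕ.≤ n
      Rel-arity : ∀ {n} → Rel n → 1 ℕ.≤ n
      λF        : ∀ {n} → Fun n → ℝ
      λR        : ∀ {n} → Rel n → ℝ
      λF-nonNeg : ∀ {n} (F : Fun n) → 0# ≤ λF F
      λR-nonNeg : ∀ {n} (R : Rel n) → 0# ≤ λR R
      d         : Rel 2
      λd≈1      : λR d ≈ 1#

  module _ (L : Language) where
    open Language L

    data Term (n : ℕ) : Set ℓ where
      var : Fin n → Term n
      con : Const → Term n
      app : ∀ {k} → Fun k → Vec (Term n) k → Term n

    -- Affine formulas with free variables among n; sup and inf bind
    -- variable zero of their body.  The atomic formula d(t₁,t₂) is
    -- atom d (t₁ ∷ t₂ ∷ []).

    data Formula (n : ℕ) : Set ℓ where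
      one     : Formula n
      atom    : ∀ {k} → Rel k → Vec (Term n) k → Formula n
      _⊕_     : Formula n → Formula n → Formula n
      _⊙_     : ℝ → Formula n → Formula n
      sup inf : Formula (suc n) → Formula n

    -- What the values of formulas depend on: no metric axiom, completeness
    -- or Lipschitz condition.  The underlying set is the setoid
    -- (Carrier , _≈ₘ_), so that sets of classes need no quotient type.

    record RawStructure : Set (lsuc ℓ) where
      field
        Carrier : Set ℓ
        _≈ₘ_    : BinRel Carrier ℓ
        ⟦con⟧   : Const → Carrier
        ⟦fun⟧   : ∀ {n} → Fun n → Vec Carrier n → Carrier
        ⟦rel⟧   : ∀ {n} → Rel n → Vec Carrier n → ℝ

      dist : Carrier → Carrier → ℝ
      dist x y = ⟦rel⟧ d (x ∷ y ∷ [])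

      distⁿ : ∀ {n} → Vec Carrier n → Vec Carrier n → ℝ
      distⁿ []       []       = 0#
      distⁿ (x ∷ xs) (y ∷ ys) = dist x y + distⁿ xs ys

      Cauchy : (ℕ → Carrier) → Set ℓ
      Cauchy u = ∀ ε → 0# < ε → ∃ λ N → ∀ m n → N ℕ.≤ m → N ℕ.≤ n →
                 dist (u m) (u n) < ε

      _ConvergesTo_ : (ℕ → Carrier) → Carrier → Set ℓ
      u ConvergesTo x = ∀ ε → 0# < ε → ∃ λ N → ∀ n → N ℕ.≤ n →
                        dist (u n) x < ε

    record Structure : Set (lsuc ℓ) where
      field
        raw : RawStructure
      open RawStructure raw public
      field
        point         : Carrier   -- structures are nonempty
        isMetric      : IsGeneralMetric _≈ₘ_ _≈_ _≤_ 0# _+_ dist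
        diameter≤1    : ∀ x y → dist x y ≤ 1#
        cauchy⇒limit  : ∀ u → Cauchy u → ∃ λ x → u ConvergesTo x
        fun-lipschitz : ∀ {n} (F : Fun n) xs ys →
                        dist (⟦fun⟧ F xs) (⟦fun⟧ F ys) ≤ λF F * distⁿ xs ys
        rel-nonNeg    : ∀ {n} (R : Rel n) xs → 0# ≤ ⟦rel⟧ R xs
        rel-≤1        : ∀ {n} (R : Rel n) xs → ⟦rel⟧ R xs ≤ 1#
        rel-lipschitz : ∀ {n} (R : Rel n) xs ys →
                        ⟦rel⟧ R xs + - ⟦rel⟧ R ys ≤ λR R * distⁿ xs ys

  module _ {L : Language} (M : RawStructure L) where
    open Language L
    open RawStructure M

    mutual
      ⟦_⟧ᵗ : ∀ {n} → Term L n → Vec Carrier n → Carrier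
      ⟦ var x    ⟧ᵗ as = lookup as x
      ⟦ con c    ⟧ᵗ as = ⟦con⟧ c
      ⟦ app F ts ⟧ᵗ as = ⟦fun⟧ F (⟦ ts ⟧ᵗˢ as)

      ⟦_⟧ᵗˢ : ∀ {n k} → Vec (Term L n) k → Vec Carrier n → Vec Carrier k
      ⟦ []     ⟧ᵗˢ as = []
      ⟦ t ∷ ts ⟧ᵗˢ as = ⟦ t ⟧ᵗ as ∷ ⟦ ts ⟧ᵗˢ as

    value : ∀ {n} → Formula L n → Vec Carrier n → ℝ
    value one         as = 1#
    value (atom R ts) as = ⟦rel⟧ R (⟦ ts ⟧ᵗˢ as)
    value (φ ⊕ ψ)     as = value φ as + value ψ as
    value (r ⊙ φ)     as = r * value φ as
    value (sup φ)     as = ⨆ λ x → value φ (x ∷ as)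
    value (inf φ)     as = ⨅ λ x → value φ (x ∷ as)

  components : {I : Set ℓ} {A : I → Set ℓ} (i : I) {n : ℕ} →
               Vec (∀ j → A j) n → Vec (A i) n
  components i = map λ a → a i

  module _ {L : Language} {I : Set ℓ} where
    open RawStructure

    -- A class [aᵢ] is represented by the family a itself; two families
    -- are equal as elements of the ultramean when ∫ dᵢ(aᵢ,bᵢ) dμ = 0.
    -- The clause for ⟦rel⟧ at R = d is the metric ∫ dᵢ(aᵢ,bᵢ) dμ.

    ultramean : Ultracharge I → (I → Structure L) → RawStructure L
    ultramean μ M = record
      { Carrier = ∀ i → Carrier (N i)
      ; _≈ₘ_    = λ a b → ∫ μ (λ i → dist (N i) (a i) (b i)) ≈ 0#
      ; ⟦con⟧   = λ c i → ⟦con⟧ (N i) c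
      ; ⟦fun⟧   = λ F as i → ⟦fun⟧ (N i) F (components i as)
      ; ⟦rel⟧   = λ R as → ∫ μ (λ i → ⟦rel⟧ (N i) R (components i as))
      }
      where
      N : I → RawStructure L
      N i = Structure.raw (M i)

{-# OPTIONS --safe #-}

-- Bounded functions are integrable, and the integral is linear and monotone, so
-- the connectives and atomic formulas are immediate by induction on φ.  For sup
-- (and dually inf), ∫ fᵢ(xᵢ) ≤ ∫ supₓ fᵢ(x) by monotonicity; conversely, choosing
-- for every i a point xᵢ with supₓ fᵢ(x) ≤ fᵢ(xᵢ) + ε gives a single element (xᵢ) of
-- the ultramean at which the integral is within ε of ∫ supₓ fᵢ(x).

module Submission where

open import Defs
open import Level using (Level; Lift; lift)
open import Axiom.ExcludedMiddle using (ExcludedMiddle)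
open import Data.Nat.Base using (ℕ)
open import Data.Vec.Base using (Vec)

open import Algebra.Bundles using (CommutativeRing)
import Algebra.Properties.AbelianGroup as AbelianGroupProperties
import Algebra.Properties.Semiring.Mult as SemiringMult
import Algebra.Properties.Semiring.Sum as SemiringSum
import Algebra.Solver.Ring.NaturalCoefficients.Default as RingSolver
open import Data.Empty using (⊥-elim)
open import Data.Fin.Base using (Fin; zero; suc; combine; quotient; remainder)
open import Data.Fin.Properties using (remQuot-combine; suc-injective)
open import Data.Nat.Base using (suc; zero)
open import Data.Product.Base using (∃; _×_; _,_; proj₁; proj₂; swap)
open import Data.Sum.Base using (inj₁; inj₂; [_,_]′)
open import Data.Unit.Polymorphic.Base using (tt)
open import Data.Vec.Base using ([]; _∷_)
open import Data.Vec.Properties using (lookup-map)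
open import Function.Base using (_∘_; const)
open import Relation.Binary.Bundles using (Poset)
open import Relation.Binary.PropositionalEquality.Core as ≡ using (_≡_)
import Relation.Binary.Reasoning.PartialOrder as PartialOrderReasoning
open import Relation.Binary.Structures using (IsTotalOrder)
open import Relation.Nullary using (¬_; yes; no; contradiction)
open import Relation.Unary using (Pred; _≐_; _∪_)

-- Arithmetic of inequalities, suprema and infima in an ordered field.

module OrderedField {ℓ : Level} (𝓡 : CompleteOrderedField ℓ) where

  open CompleteOrderedField 𝓡 public renaming (Carrier to ℝ)

  commutativeRing : CommutativeRing ℓ ℓ
  commutativeRing = record { isCommutativeRing = isCommutativeRing }

  open CommutativeRing commutativeRing public
    using ( semiring; commutativeSemiring; +-abelianGroup; refl; sym; trans; reflexive
          ; +-cong; +-congˡ; +-congʳ; +-comm; +-assoc; +-identityˡ; +-identityʳ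
          ; -‿inverseˡ; -‿inverseʳ; *-congˡ; *-congʳ; *-comm; *-assoc; *-identityˡ; *-identityʳ
          ; zeroˡ; zeroʳ; distribˡ; distribʳ )
  open IsTotalOrder isTotalOrder public
    using (total; antisym; ≤-respˡ-≈; ≤-respʳ-≈)
    renaming (refl to ≤-refl; reflexive to ≤-reflexive; trans to ≤-trans)
  open RingSolver commutativeSemiring public using (solve; _:+_; _:*_; _:=_)
  open SemiringMult semiring public using () renaming (_×_ to _·_)
  open SemiringSum semiring public using (∑-comm; ∑-distrib-+; sum-cong-≋; *-distribˡ-sum)

  poset : Poset ℓ ℓ ℓ
  poset = record { isPartialOrder = IsTotalOrder.isPartialOrder isTotalOrder }

  open PartialOrderReasoning poset public

  x-y+y≈x : ∀ x y → x + - y + y ≈ x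
  x-y+y≈x x y = trans (+-assoc x (- y) y)
    (trans (+-congˡ (-‿inverseˡ y)) (+-identityʳ x))

  -- Writing x ≤ y as x + e ≈ y turns proofs of inequalities into semiring
  -- identities, which the solver with natural coefficients can prove.
  gap : ∀ {x y} → x ≤ y → ∃ λ e → 0# ≤ e × x + e ≈ y
  gap {x} {y} x≤y = y + - x
    , ≤-respˡ-≈ (-‿inverseʳ x) (+-monoˡ-≤ (- x) x≤y)
    , trans (+-comm x _) (x-y+y≈x y x)

  gap⁻¹ : ∀ {x y e} → 0# ≤ e → x + e ≈ y → x ≤ y
  gap⁻¹ {x} {y} {e} 0≤e x+e≈y = begin
    x      ≈⟨ +-identityˡ x ⟨
    0# + x ≤⟨ +-monoˡ-≤ x 0≤e ⟩
    e + x  ≈⟨ +-comm e x ⟩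
    x + e  ≈⟨ x+e≈y ⟩
    y      ∎

  +-monoʳ-≤ : ∀ z {x y} → x ≤ y → z + x ≤ z + y
  +-monoʳ-≤ z {x} {y} x≤y = begin
    z + x ≈⟨ +-comm z x ⟩
    x + z ≤⟨ +-monoˡ-≤ z x≤y ⟩
    y + z ≈⟨ +-comm y z ⟩
    z + y ∎

  +-mono-≤ : ∀ {x y u v} → x ≤ y → u ≤ v → x + u ≤ y + v
  +-mono-≤ x≤y u≤v = ≤-trans (+-monoˡ-≤ _ x≤y) (+-monoʳ-≤ _ u≤v)

  +-cancelʳ-≤ : ∀ z {x y} → x + z ≤ y + z → x ≤ y
  +-cancelʳ-≤ z {x} {y} x+z≤y+z with gap x+z≤y+z
  ... | e , 0≤e , p = gap⁻¹ 0≤e (∙-cancelʳ z (x + e) y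
          (trans (solve 3 (λ x e z → (x :+ e) :+ z := (x :+ z) :+ e) refl x e z) p))
    where open AbelianGroupProperties +-abelianGroup using (∙-cancelʳ)

  *-monoˡ-≤ : ∀ {c x y} → 0# ≤ c → x ≤ y → c * x ≤ c * y
  *-monoˡ-≤ {c} {x} 0≤c x≤y with gap x≤y
  ... | e , 0≤e , p = gap⁻¹ (*-nonNeg 0≤c 0≤e) (trans (sym (distribˡ c x e)) (*-congˡ p))

  -- With `c + e ≈ 0#` and `x + f ≈ y`, the gap between the two products is `e * f`.
  *-antiˡ-≤ : ∀ {c x y} → c ≤ 0# → x ≤ y → c * y ≤ c * x
  *-antiˡ-≤ {c} {x} {y} c≤0 x≤y with gap c≤0 | gap x≤y
  ... | e , 0≤e , p | f , 0≤f , q = gap⁻¹ (*-nonNeg 0≤e 0≤f) (begin-equality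
    c * y + e * f       ≈⟨ +-congʳ (*-congˡ q) ⟨
    c * (x + f) + e * f ≈⟨ solve 4 (λ c x e f → c :* (x :+ f) :+ e :* f := c :* x :+ (c :+ e) :* f)
                             refl c x e f ⟩
    c * x + (c + e) * f ≈⟨ +-congˡ (trans (*-congʳ p) (zeroˡ f)) ⟩
    c * x + 0#          ≈⟨ +-identityʳ _ ⟩
    c * x               ∎)

  0≤1 : 0# ≤ 1#
  0≤1 with total 0# 1#
  ... | inj₁ p = p
  -- If `1# ≤ 0#`, multiplying this inequality by the nonpositive `1#` reverses it.
  ... | inj₂ p = begin
    0#      ≈⟨ zeroʳ 1# ⟨
    1# * 0# ≤⟨ *-antiˡ-≤ p p ⟩
    1# * 1# ≈⟨ *-identityʳ 1# ⟩
    1#      ∎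

  x≤x+ε : ∀ x {ε} → 0# ≤ ε → x ≤ x + ε
  x≤x+ε x 0≤ε = gap⁻¹ 0≤ε refl

  x+ε≰x : ∀ {x ε} → 0# < ε → ¬ x + ε ≤ x
  x+ε≰x {x} {ε} (0≤ε , 0≉ε) x+ε≤x = 0≉ε (antisym 0≤ε (+-cancelʳ-≤ x (begin
    ε + x  ≈⟨ +-comm ε x ⟩
    x + ε  ≤⟨ x+ε≤x ⟩
    x      ≈⟨ +-identityˡ x ⟨
    0# + x ∎)))

  sum-mono-≤ : ∀ {n} {x y : Fin n → ℝ} → (∀ k → x k ≤ y k) → sum x ≤ sum y
  sum-mono-≤ {zero}  x≤y = ≤-refl
  sum-mono-≤ {suc n} x≤y = +-mono-≤ (x≤y zero) (sum-mono-≤ (x≤y ∘ suc))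

  sup-unique : ∀ {S r s} → IsSupremum S r → IsSupremum S s → r ≈ s
  sup-unique (ub₁ , least₁) (ub₂ , least₂) = antisym (least₁ _ ub₂) (least₂ _ ub₁)

  inf-unique : ∀ {S r s} → IsInfimum S r → IsInfimum S s → r ≈ s
  inf-unique (lb₁ , greatest₁) (lb₂ , greatest₂) = antisym (greatest₂ _ lb₁) (greatest₁ _ lb₂)

  -- The infimum is obtained as the supremum of the set of lower bounds, which any element of `S`
  -- bounds above.
  complete-inf : (S : Pred ℝ ℓ) → ∃ S → ∃ (IsLowerBound S) → ∃ (IsInfimum S)
  complete-inf S (x , x∈S) lb with complete (IsLowerBound S) lb (x , λ l l≤S → l≤S x x∈S)
  ... | s , ub , least = s , (λ y y∈S → least y (λ l l≤S → l≤S y y∈S)) , ub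

  sup-resp : ∀ {S T r s} → S ≐ T → r ≈ s → IsSupremum S r → IsSupremum T s
  sup-resp (S⊆T , T⊆S) r≈s (ub , least) =
    (λ x x∈T → ≤-respʳ-≈ r≈s (ub x (T⊆S x∈T))) ,
    (λ u u≥T → ≤-respˡ-≈ r≈s (least u (λ x x∈S → u≥T x (S⊆T x∈S))))

  inf-resp : ∀ {S T r s} → S ≐ T → r ≈ s → IsInfimum S r → IsInfimum T s
  inf-resp (S⊆T , T⊆S) r≈s (lb , greatest) =
    (λ x x∈T → ≤-respˡ-≈ r≈s (lb x (T⊆S x∈T))) ,
    (λ l l≤T → ≤-respʳ-≈ r≈s (greatest l (λ x x∈S → l≤T x (S⊆T x∈S))))

-- Arguments up to ε, the Archimedean property, and definite descriptions.

module Integration {ℓ : Level} (em : ExcludedMiddle ℓ) (𝓡 : CompleteOrderedField ℓ) where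

  open OrderedField 𝓡
  open AffineLogic em 𝓡

  -- The slack is c * ε, so that sums and multiples of ε-approximations need
  -- no division of ε.
  ≤-by-slack : ∀ {c x y} → 0# ≤ c → (∀ ε → 0# < ε → x ≤ y + c * ε) → x ≤ y
  ≤-by-slack {c} {x} {y} 0≤c slack with total x y | em {y ≈ x}
  ... | inj₁ x≤y | _       = x≤y
  ... | inj₂ _   | yes y≈x = ≤-reflexive (sym y≈x)
  ... | inj₂ y≤x | no  y≉x = ⊥-elim (x+ε≰x (0≤ew , ew≉0) x+ew≤x)
    where
    -- Take the slack at `e * w` with `e` the difference of `x` and `y` and `w` the inverse of
    -- `c + 1#`: one further `e * w` on top of `c * (e * w)` makes exactly `e`, so `x + e * w ≤ x`.
    K : ℝ
    K = c + 1#

    1≤K : 1# ≤ K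
    1≤K = gap⁻¹ 0≤c (+-comm 1# c)

    K≉0 : ¬ K ≈ 0#
    K≉0 K≈0 = 0≉1 (antisym 0≤1 (≤-respʳ-≈ K≈0 1≤K))

    w e : ℝ
    w = proj₁ (inverse K K≉0)
    e = proj₁ (gap y≤x)

    Kw≈1 : K * w ≈ 1#
    Kw≈1 = proj₂ (inverse K K≉0)

    0≤e : 0# ≤ e
    0≤e = proj₁ (proj₂ (gap y≤x))

    y+e≈x : y + e ≈ x
    y+e≈x = proj₂ (proj₂ (gap y≤x))

    0≤w : 0# ≤ w
    0≤w with total 0# w
    ... | inj₁ p = p
    ... | inj₂ w≤0 = contradiction (antisym 0≤1 (begin
      1#     ≈⟨ Kw≈1 ⟨
      K * w  ≤⟨ *-monoˡ-≤ (≤-trans 0≤1 1≤K) w≤0 ⟩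
      K * 0# ≈⟨ zeroʳ K ⟩
      0#     ∎)) 0≉1

    Kew≈e : K * (e * w) ≈ e
    Kew≈e = begin-equality
      K * (e * w) ≈⟨ solve 3 (λ K e w → K :* (e :* w) := e :* (K :* w)) refl K e w ⟩
      e * (K * w) ≈⟨ *-congˡ Kw≈1 ⟩
      e * 1#      ≈⟨ *-identityʳ e ⟩
      e           ∎

    ew≉0 : ¬ 0# ≈ e * w
    ew≉0 0≈ew = y≉x (begin-equality
      y               ≈⟨ +-identityʳ y ⟨
      y + 0#          ≈⟨ +-congˡ (zeroʳ K) ⟨
      y + K * 0#      ≈⟨ +-congˡ (*-congˡ 0≈ew) ⟩
      y + K * (e * w) ≈⟨ +-congˡ Kew≈e ⟩
      y + e           ≈⟨ y+e≈x ⟩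
      x               ∎)

    0≤ew : 0# ≤ e * w
    0≤ew = *-nonNeg 0≤e 0≤w

    x+ew≤x : x + e * w ≤ x
    x+ew≤x = begin
      x + e * w                        ≤⟨ +-monoˡ-≤ _ (slack (e * w) (0≤ew , ew≉0)) ⟩
      (y + c * (e * w)) + e * w        ≈⟨ +-assoc y _ _ ⟩
      y + (c * (e * w) + e * w)        ≈⟨ +-congˡ (+-congˡ (*-identityˡ _)) ⟨
      y + (c * (e * w) + 1# * (e * w)) ≈⟨ +-congˡ (distribʳ _ c 1#) ⟨
      y + K * (e * w)                  ≈⟨ +-congˡ Kew≈e ⟩
      y + e                            ≈⟨ y+e≈x ⟩
      x                                ∎

  ≤-by-ε : ∀ {x y} → (∀ ε → 0# < ε → x ≤ y + ε) → x ≤ y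
  ≤-by-ε {x} {y} slack = ≤-by-slack 0≤1 λ ε 0<ε →
    ≤-respʳ-≈ (+-congˡ (sym (*-identityˡ ε))) (slack ε 0<ε)

  module _ {S : Pred ℝ ℓ} {s ε : ℝ} (0<ε : 0# < ε) where

    -- Otherwise `s + - ε` would be a smaller upper bound.
    sup-no-gap : IsSupremum S s → ¬ (∀ x → S x → x + ε ≤ s)
    sup-no-gap (_ , least) x+ε≤s = x+ε≰x 0<ε (begin
      s + ε       ≤⟨ +-monoˡ-≤ ε (least (s + - ε) (λ x x∈S →
                       +-cancelʳ-≤ ε (≤-respʳ-≈ (sym (x-y+y≈x s ε)) (x+ε≤s x x∈S)))) ⟩
      s + - ε + ε ≈⟨ x-y+y≈x s ε ⟩
      s           ∎)

    sup-approx : IsSupremum S s → ∃ λ x → S x × s ≤ x + ε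
    sup-approx isSup with em {∃ λ x → S x × s ≤ x + ε}
    ... | yes p    = p
    ... | no  none = ⊥-elim (sup-no-gap isSup λ x x∈S →
      [ (λ p → p) , (λ s≤x+ε → contradiction (x , x∈S , s≤x+ε) none) ]′ (total (x + ε) s))

    inf-approx : IsInfimum S s → ∃ λ x → S x × x ≤ s + ε
    inf-approx (_ , greatest) with em {∃ λ x → S x × x ≤ s + ε}
    ... | yes p    = p
    ... | no  none = ⊥-elim (x+ε≰x 0<ε (greatest (s + ε) λ x x∈S →
      [ (λ p → p) , (λ x≤s+ε → contradiction (x , x∈S , x≤s+ε) none) ]′ (total (s + ε) x)))

  -- If `x` bounded all multiples of `ε`, they would have a supremum. With each multiple `r` also
  -- `ε + r` is a multiple, so all of them would stay `ε` below it, against `sup-no-gap`.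
  archimedean : ∀ {ε} → 0# < ε → ∀ x → ∃ λ n → x ≤ n · ε
  archimedean {ε} 0<ε x with em {∃ λ n → x ≤ n · ε}
  ... | yes p    = p
  ... | no  none = ⊥-elim (sup-no-gap 0<ε isSup λ r (n , r≈nε) → begin
      r + ε       ≈⟨ +-comm r ε ⟩
      ε + r       ≤⟨ proj₁ isSup (ε + r) (suc n , +-congˡ r≈nε) ⟩
      _           ∎)
    where
    Multiple : Pred ℝ ℓ
    Multiple r = ∃ λ n → r ≈ n · ε

    multiple≤x : IsUpperBound Multiple x
    multiple≤x r (n , r≈nε) with total r x
    ... | inj₁ r≤x = r≤x
    ... | inj₂ x≤r = contradiction (n , ≤-respʳ-≈ r≈nε x≤r) none

    isSup : IsSupremum Multiple _
    isSup = proj₂ (complete Multiple (0# , 0 , refl) (x , multiple≤x))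

  -- The witness inside `the` is whatever excluded middle supplies; uniqueness identifies it with
  -- the known `x`, whose existence rules out the default `0#`.
  the-≈ : {P : Pred ℝ ℓ} → (∀ {x y} → P x → P y → x ≈ y) → ∀ {x} → P x → the P ≈ x
  the-≈ {P} unique {x} px with em {∃ P}
  ... | yes (_ , py) = unique py px
  ... | no  ∄        = contradiction (x , px) ∄

  module _ {A : Set ℓ} where

    range-cong : {f g : A → ℝ} → (∀ a → f a ≈ g a) → range f ≐ range g
    range-cong f≈g = (λ (a , p) → a , trans p (f≈g a)) , (λ (a , p) → a , trans p (sym (f≈g a)))

    ⨆-≈ : {f : A → ℝ} {r : ℝ} → IsSupremum (range f) r → ⨆ f ≈ r
    ⨆-≈ = the-≈ sup-unique

    ⨅-≈ : {f : A → ℝ} {r : ℝ} → IsInfimum (range f) r → ⨅ f ≈ r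
    ⨅-≈ = the-≈ inf-unique

    module _ {f : A → ℝ} (a₀ : A) {b : ℝ} where

      ⨆-isSupremum : (∀ a → f a ≤ b) → IsSupremum (range f) (⨆ f)
      ⨆-isSupremum f≤b
        with complete (range f) (f a₀ , a₀ , refl) (b , λ r (a , p) → ≤-respˡ-≈ (sym p) (f≤b a))
      ... | s , isSup = sup-resp ((λ p → p) , (λ p → p)) (sym (⨆-≈ isSup)) isSup

      ⨅-isInfimum : (∀ a → b ≤ f a) → IsInfimum (range f) (⨅ f)
      ⨅-isInfimum b≤f
        with complete-inf (range f) (f a₀ , a₀ , refl) (b , λ r (a , p) → ≤-respʳ-≈ (sym p) (b≤f a))
      ... | s , isInf = inf-resp ((λ p → p) , (λ p → p)) (sym (⨅-≈ isInf)) isInf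

  -- Ultracharges and integrals of simple functions.

  module _ {I : Set ℓ} (μ : Ultracharge I) where

    open Ultracharge μ renaming (cong to measure-cong; total to measure-total)
    open Simple

    -- An empty set is disjoint from itself and equals its union with itself, so its measure is its
    -- own double.
    measure-empty : ∀ {A : Pred I ℓ} → (∀ i → ¬ A i) → measure A ≈ 0#
    measure-empty {A} empty = ∙-cancelʳ (measure A) (measure A) 0# (begin-equality
      measure A + measure A ≈⟨ additive {A} {A} (λ (p , _) → empty _ p) ⟨
      measure (A ∪ A)       ≈⟨ measure-cong {A ∪ A} {A} ([ (λ p → p) , (λ p → p) ]′ , inj₁) ⟩
      measure A             ≈⟨ +-identityˡ _ ⟨
      0# + measure A        ∎)
      where open AbelianGroupProperties +-abelianGroup using (∙-cancelʳ)

    measure-⋃ : ∀ {n} (B : Fin n → Pred I ℓ) → (∀ {i j k} → B j i → B k i → j ≡ k) →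
                measure (λ i → ∃ λ k → B k i) ≈ sum (λ k → measure (B k))
    measure-⋃ {zero}  B disjoint = measure-empty (λ { _ (() , _) })
    measure-⋃ {suc n} B disjoint = begin-equality
      measure (λ i → ∃ λ k → B k i)
        ≈⟨ measure-cong ( (λ { (zero , p) → inj₁ p ; (suc k , p) → inj₂ (k , p) })
                        , [ (zero ,_) , (λ (k , p) → suc k , p) ]′ ) ⟩
      measure (B zero ∪ (λ i → ∃ λ k → B (suc k) i))
        ≈⟨ additive (λ (p , k , q) → case (disjoint p q)) ⟩
      measure (B zero) + measure (λ i → ∃ λ k → B (suc k) i)
        ≈⟨ +-congˡ (measure-⋃ (B ∘ suc) (λ p q → suc-injective (disjoint p q))) ⟩
      sum (λ k → measure (B k)) ∎
      where
      case : ∀ {k : Fin n} → ¬ zero ≡ suc k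
      case ()

    Cell : ∀ {n} → (I → Fin n) → Fin n → Pred I ℓ
    Cell cell k i = Lift ℓ (cell i ≡ k)

    -- With `A` a cell of another partition, this computes the marginals of a common refinement.
    measure-cells : ∀ {n} (cell : I → Fin n) (A : Pred I ℓ) →
                    measure A ≈ sum (λ k → measure (λ i → A i × Cell cell k i))
    measure-cells cell A = trans
      (measure-cong ((λ p → cell _ , p , lift ≡.refl) , (λ (_ , p , _) → p)))
      (measure-⋃ (λ k i → A i × Cell cell k i)
                 (λ { (_ , lift p) (_ , lift q) → ≡.trans (≡.sym p) q }))

    -- Both integrals become double sums over the intersections of a cell of `s` with a cell of `t`,
    -- where they are compared term by term.
    ∫-simple-mono : (s t : Simple I) → (∀ i → at s i ≤ at t i) → ∫-simple μ s ≤ ∫-simple μ t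
    ∫-simple-mono s t s≤t = begin
      sum (λ k → coeff s k * measure (Cell (cell s) k))
        ≈⟨ sum-cong-≋ (λ k → *-congˡ {coeff s k} (measure-cells (cell t) (Cell (cell s) k))) ⟩
      sum (λ k → coeff s k * sum (λ l → m k l))
        ≈⟨ sum-cong-≋ (λ k → *-distribˡ-sum (coeff s k) (m k)) ⟩
      sum (λ k → sum (λ l → coeff s k * m k l))
        ≤⟨ sum-mono-≤ (λ k → sum-mono-≤ (λ l → termwise k l)) ⟩
      sum (λ k → sum (λ l → coeff t l * m k l))
        ≈⟨ ∑-comm (λ k l → coeff t l * m k l) ⟩
      sum (λ l → sum (λ k → coeff t l * m k l))
        ≈⟨ sum-cong-≋ (λ l → *-distribˡ-sum (coeff t l) (λ k → m k l)) ⟨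
      sum (λ l → coeff t l * sum (λ k → m k l))
        ≈⟨ sum-cong-≋ (λ l → *-congˡ {coeff t l} (marginal l)) ⟨
      sum (λ l → coeff t l * measure (Cell (cell t) l)) ∎
      where
      Both : Fin (size s) → Fin (size t) → Pred I ℓ
      Both k l i = Cell (cell s) k i × Cell (cell t) l i

      m : Fin (size s) → Fin (size t) → ℝ
      m k l = measure (Both k l)

      marginal : ∀ l → measure (Cell (cell t) l) ≈ sum (λ k → m k l)
      marginal l = begin-equality
        measure (Cell (cell t) l)
          ≈⟨ measure-cells (cell s) (Cell (cell t) l) ⟩
        sum (λ k → measure (λ i → Cell (cell t) l i × Cell (cell s) k i))
          ≈⟨ sum-cong-≋ {size s} (λ k → measure-cong (swap , swap)) ⟩
        sum (λ k → m k l) ∎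

      termwise : ∀ k l → coeff s k * m k l ≤ coeff t l * m k l
      termwise k l with em {∃ (Both k l)}
      -- On an empty intersection the coefficients may be in the wrong order, but the weight is
      -- zero. Otherwise a common point `i` compares them.
      ... | no empty = ≤-reflexive (trans (*-congˡ m≈0) (trans (trans (zeroʳ _) (sym (zeroʳ _)))
                         (*-congˡ (sym m≈0))))
        where
        m≈0 : m k l ≈ 0#
        m≈0 = measure-empty (λ i p → empty (i , p))
      ... | yes (i , lift ≡.refl , lift ≡.refl) = begin
        coeff s k * m k l ≈⟨ *-comm _ _ ⟩
        m k l * coeff s k ≤⟨ *-monoˡ-≤ (nonNegative _) (s≤t i) ⟩
        m k l * coeff t l ≈⟨ *-comm _ _ ⟩
        coeff t l * m k l ∎

    -- Makes the integral independent of the partition used to present a simple function.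
    ∫-simple-cong : (s t : Simple I) → (∀ i → at s i ≈ at t i) → ∫-simple μ s ≈ ∫-simple μ t
    ∫-simple-cong s t s≈t = antisym (∫-simple-mono s t (≤-reflexive ∘ s≈t))
                                    (∫-simple-mono t s (≤-reflexive ∘ sym ∘ s≈t))

    constant : ℝ → Simple I
    constant c = record { size = 1 ; cell = const zero ; coeff = const c }

    ∫-constant : ∀ c → ∫-simple μ (constant c) ≈ c
    ∫-constant c = begin-equality
      c * measure (Cell (cell (constant c)) zero) + 0# ≈⟨ +-identityʳ _ ⟩
      c * measure (Cell (cell (constant c)) zero)
        ≈⟨ *-congˡ (trans (measure-cong ((λ _ → tt) , (λ _ → lift ≡.refl))) measure-total) ⟩
      c * 1#                                           ≈⟨ *-identityʳ c ⟩
      c                                                ∎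

    -- The sum lives on the common refinement, whose cells are pairs coded by `combine`; some of
    -- them may be empty.
    _⊞_ : Simple I → Simple I → Simple I
    s ⊞ t = record
      { cell  = λ i → combine (cell s i) (cell t i)
      ; coeff = λ j → coeff s (quotient (size t) j) + coeff t (remainder {size s} (size t) j)
      }

    at-⊞ : ∀ s t i → at (s ⊞ t) i ≡ at s i + at t i
    at-⊞ s t i = ≡.cong (λ (k , l) → coeff s k + coeff t l) (remQuot-combine (cell s i) (cell t i))

    -- The sum splits over the refinement into two halves that agree pointwise with `s` and `t`, so
    -- `∫-simple-cong` returns them to their own partitions.
    ∫-⊞ : ∀ s t → ∫-simple μ (s ⊞ t) ≈ ∫-simple μ s + ∫-simple μ t
    ∫-⊞ s t = begin-equality
      sum (λ j → (coeff s′ j + coeff t′ j) * m j)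
        ≈⟨ sum-cong-≋ (λ j → distribʳ (m j) (coeff s′ j) (coeff t′ j)) ⟩
      sum (λ j → coeff s′ j * m j + coeff t′ j * m j)
        ≈⟨ ∑-distrib-+ (λ j → coeff s′ j * m j) (λ j → coeff t′ j * m j) ⟩
      ∫-simple μ s′ + ∫-simple μ t′
        ≈⟨ +-cong (∫-simple-cong s′ s λ i → reflexive (≡.cong (coeff s ∘ proj₁) (split i)))
                  (∫-simple-cong t′ t λ i → reflexive (≡.cong (coeff t ∘ proj₂) (split i))) ⟩
      ∫-simple μ s + ∫-simple μ t ∎
      where
      -- s and t written on their common refinement
      s′ t′ : Simple I
      s′ = record { cell = cell (s ⊞ t) ; coeff = coeff s ∘ quotient (size t) }
      t′ = record { cell = cell (s ⊞ t) ; coeff = coeff t ∘ remainder {size s} (size t) }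

      split = λ i → remQuot-combine (cell s i) (cell t i)

      m : Fin (size (s ⊞ t)) → ℝ
      m j = measure (Cell (cell (s ⊞ t)) j)

    _⊡_ : ℝ → Simple I → Simple I
    c ⊡ s = record { cell = cell s ; coeff = λ k → c * coeff s k }

    ∫-⊡ : ∀ c s → ∫-simple μ (c ⊡ s) ≈ c * ∫-simple μ s
    ∫-⊡ c s = trans (sum-cong-≋ (λ k → *-assoc c (coeff s k) (measure (Cell (cell s) k))))
      (sym (*-distribˡ-sum c (λ k → coeff s k * measure (Cell (cell s) k))))

    -- Integrability by sandwiching; linearity and monotonicity of the integral.

    record Approx (f : I → ℝ) (r ε : ℝ) : Set ℓ where
      field
        lower upper : Simple I
        lower≤f     : ∀ i → at lower i ≤ f i
        f≤upper     : ∀ i → f i ≤ at upper i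
        r≤lower+ε   : r ≤ ∫-simple μ lower + ε
        upper≤r+ε   : ∫-simple μ upper ≤ r + ε

    open Approx

    -- A simple function below `f` lies below `upper`, and one above `f` lies above `lower`; this
    -- bounds all lower and upper sums by `r` up to the slack. The sandwiching functions themselves
    -- show that `r` is optimal.
    approx⇒integral : ∀ {f r c} → 0# ≤ c → (∀ ε → 0# < ε → Approx f r (c * ε)) →
                      IsIntegral μ f r
    approx⇒integral {f} {r} {c} 0≤c approx =
      ( (λ x (s , s≤f , x≈∫s) → ≤-by-slack 0≤c λ ε 0<ε → let A = approx ε 0<ε in begin
          x                      ≈⟨ x≈∫s ⟩
          ∫-simple μ s           ≤⟨ ∫-simple-mono s (upper A) (λ i → ≤-trans (s≤f i) (f≤upper A i)) ⟩
          ∫-simple μ (upper A)   ≤⟨ upper≤r+ε A ⟩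
          r + c * ε              ∎)
      , (λ u u≥ → ≤-by-slack 0≤c λ ε 0<ε → let A = approx ε 0<ε in
          ≤-trans (r≤lower+ε A) (+-monoˡ-≤ _ (u≥ _ (lower A , lower≤f A , refl)))) ) ,
      ( (λ x (s , f≤s , x≈∫s) → ≤-by-slack 0≤c λ ε 0<ε → let A = approx ε 0<ε in begin
          r                              ≤⟨ r≤lower+ε A ⟩
          ∫-simple μ (lower A) + c * ε   ≤⟨ +-monoˡ-≤ _ (∫-simple-mono (lower A) s
                                              (λ i → ≤-trans (lower≤f A i) (f≤s i))) ⟩
          ∫-simple μ s + c * ε           ≈⟨ +-congʳ x≈∫s ⟨
          x + c * ε                      ∎)
      , (λ l l≤ → ≤-by-slack 0≤c λ ε 0<ε → let A = approx ε 0<ε in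
          ≤-trans (l≤ _ (upper A , f≤upper A , refl)) (upper≤r+ε A)) )

    integral⇒approx : ∀ {f r} → IsIntegral μ f r → ∀ ε → 0# < ε → Approx f r ε
    integral⇒approx (isSup , isInf) ε 0<ε with sup-approx 0<ε isSup | inf-approx 0<ε isInf
    ... | x , (s , s≤f , x≈∫s) , r≤x+ε | y , (t , f≤t , y≈∫t) , y≤r+ε = record
      { lower     = s
      ; upper     = t
      ; lower≤f   = s≤f
      ; f≤upper   = f≤t
      ; r≤lower+ε = ≤-respʳ-≈ (+-congʳ x≈∫s) r≤x+ε
      ; upper≤r+ε = ≤-respˡ-≈ y≈∫t y≤r+ε
      }

    ∫-≈ : ∀ {f r} → IsIntegral μ f r → ∫ μ f ≈ r
    ∫-≈ = the-≈ (λ (p , _) (q , _) → sup-unique p q)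

    integral-resp : ∀ {f g r s} → (∀ i → f i ≈ g i) → r ≈ s → IsIntegral μ f r → IsIntegral μ g s
    integral-resp f≈g r≈s (isSup , isInf) =
      sup-resp ( (λ (u , u≤f , p) → u , (λ i → ≤-respʳ-≈ (f≈g i) (u≤f i)) , p)
               , (λ (u , u≤g , p) → u , (λ i → ≤-respʳ-≈ (sym (f≈g i)) (u≤g i)) , p) ) r≈s isSup ,
      inf-resp ( (λ (u , f≤u , p) → u , (λ i → ≤-respˡ-≈ (f≈g i) (f≤u i)) , p)
               , (λ (u , g≤u , p) → u , (λ i → ≤-respˡ-≈ (sym (f≈g i)) (g≤u i)) , p) ) r≈s isInf

    integral-mono : ∀ {f g r s} → (∀ i → f i ≤ g i) → IsIntegral μ f r → IsIntegral μ g s → r ≤ s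
    integral-mono f≤g ((_ , least) , _) ((ub , _) , _) =
      least _ λ x (u , u≤f , p) → ub x (u , (λ i → ≤-trans (u≤f i) (f≤g i)) , p)

    integral-constant : ∀ c → IsIntegral μ (const c) c
    integral-constant c = approx⇒integral 0≤1 λ ε 0<ε →
      let c≤c+ε = x≤x+ε c (*-nonNeg 0≤1 (proj₁ 0<ε)) in record
      { lower     = constant c
      ; upper     = constant c
      ; lower≤f   = λ _ → ≤-refl
      ; f≤upper   = λ _ → ≤-refl
      ; r≤lower+ε = ≤-respʳ-≈ (+-congʳ (sym (∫-constant c))) c≤c+ε
      ; upper≤r+ε = ≤-respˡ-≈ (sym (∫-constant c)) c≤c+ε
      }

    integral-+ : ∀ {f g r s} → IsIntegral μ f r → IsIntegral μ g s →
                 IsIntegral μ (λ i → f i + g i) (r + s)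
    -- The two errors add up, so the slack constant is `1# + 1#`.
    integral-+ {f} {g} {r} {s} ∫f ∫g = approx⇒integral (≤-trans 0≤1 (x≤x+ε 1# 0≤1)) λ ε 0<ε →
      let A = integral⇒approx ∫f ε 0<ε
          B = integral⇒approx ∫g ε 0<ε
      in record
      { lower     = lower A ⊞ lower B
      ; upper     = upper A ⊞ upper B
      ; lower≤f   = λ i → ≤-respˡ-≈ (reflexive (≡.sym (at-⊞ (lower A) (lower B) i)))
                            (+-mono-≤ (lower≤f A i) (lower≤f B i))
      ; f≤upper   = λ i → ≤-respʳ-≈ (reflexive (≡.sym (at-⊞ (upper A) (upper B) i)))
                            (+-mono-≤ (f≤upper A i) (f≤upper B i))
      ; r≤lower+ε = begin
          r + s ≤⟨ +-mono-≤ (r≤lower+ε A) (r≤lower+ε B) ⟩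
          _     ≈⟨ double _ _ ε ⟩
          _     ≈⟨ +-congʳ (∫-⊞ (lower A) (lower B)) ⟨
          _     ∎
      ; upper≤r+ε = begin
          _     ≈⟨ ∫-⊞ (upper A) (upper B) ⟩
          _     ≤⟨ +-mono-≤ (upper≤r+ε A) (upper≤r+ε B) ⟩
          _     ≈⟨ double r s ε ⟩
          _     ∎
      }
      where
      double : ∀ x y ε → (x + ε) + (y + ε) ≈ (x + y) + (1# + 1#) * ε
      double x y ε = trans (solve 3 (λ x y e → (x :+ e) :+ (y :+ e) := (x :+ y) :+ (e :+ e))
          refl x y ε)
        (+-congˡ (sym (trans (distribʳ ε 1# 1#) (+-cong (*-identityˡ ε) (*-identityˡ ε)))))

    integral-* : ∀ c {f r} → IsIntegral μ f r → IsIntegral μ (λ i → c * f i) (c * r)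
    integral-* c {f} {r} ∫f with total 0# c
    ... | inj₁ 0≤c = approx⇒integral 0≤c λ ε 0<ε → let A = integral⇒approx ∫f ε 0<ε in record
      { lower     = c ⊡ lower A
      ; upper     = c ⊡ upper A
      ; lower≤f   = λ i → *-monoˡ-≤ 0≤c (lower≤f A i)
      ; f≤upper   = λ i → *-monoˡ-≤ 0≤c (f≤upper A i)
      ; r≤lower+ε = begin
          c * r ≤⟨ *-monoˡ-≤ 0≤c (r≤lower+ε A) ⟩
          _     ≈⟨ distribˡ c _ ε ⟩
          _     ≈⟨ +-congʳ (∫-⊡ c (lower A)) ⟨
          _     ∎
      ; upper≤r+ε = begin
          _     ≈⟨ ∫-⊡ c (upper A) ⟩
          _     ≤⟨ *-monoˡ-≤ 0≤c (upper≤r+ε A) ⟩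
          _     ≈⟨ distribˡ c r ε ⟩
          _     ∎
      }
    ... | inj₂ c≤0 with gap c≤0
    -- A nonpositive factor exchanges lower and upper functions; the error is scaled by `b`, the
    -- negative of `c`.
    ... | b , 0≤b , c+b≈0 = approx⇒integral 0≤b λ ε 0<ε → let A = integral⇒approx ∫f ε 0<ε in record
      { lower     = c ⊡ upper A
      ; upper     = c ⊡ lower A
      ; lower≤f   = λ i → *-antiˡ-≤ c≤0 (f≤upper A i)
      ; f≤upper   = λ i → *-antiˡ-≤ c≤0 (lower≤f A i)
      ; r≤lower+ε = ≤-respʳ-≈ (+-congʳ (sym (∫-⊡ c (upper A)))) (flip ε (upper≤r+ε A))
      ; upper≤r+ε = ≤-respˡ-≈ (sym (∫-⊡ c (lower A))) (flip ε (r≤lower+ε A))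
      }
      where
      flip : ∀ {x y} ε → x ≤ y + ε → c * y ≤ c * x + b * ε
      flip {x} {y} ε x≤y+ε = begin
        c * y                       ≈⟨ +-identityʳ _ ⟨
        c * y + 0#                  ≈⟨ +-congˡ (trans (*-congʳ c+b≈0) (zeroˡ ε)) ⟨
        c * y + (c + b) * ε         ≈⟨ solve 4 (λ c b y e →
                                         c :* y :+ (c :+ b) :* e := c :* (y :+ e) :+ b :* e)
                                         refl c b y ε ⟩
        c * (y + ε) + b * ε         ≤⟨ +-monoˡ-≤ _ (*-antiˡ-≤ c≤0 x≤y+ε) ⟩
        c * x + b * ε               ∎

    -- Bounded functions are integrable.

    grid : ∀ {n} → ℝ → ℝ → Fin n → ℝ
    grid ε lo zero    = lo
    grid ε lo (suc k) = grid ε (lo + ε) k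

    -- Scans from the left: either `y` lies in the first cell, or the search continues from `lo + ε`
    -- with one cell fewer.
    floor : ∀ ε n lo y → lo ≤ y → y ≤ lo + suc n · ε →
            ∃ λ (k : Fin (suc n)) → grid ε lo k ≤ y × y ≤ grid ε lo k + ε
    floor ε zero    lo y lo≤y y≤hi = zero , lo≤y , ≤-respʳ-≈ (+-congˡ (+-identityʳ ε)) y≤hi
    floor ε (suc n) lo y lo≤y y≤hi with total y (lo + ε)
    ... | inj₁ y≤lo+ε = zero , lo≤y , y≤lo+ε
    ... | inj₂ lo+ε≤y with floor ε n (lo + ε) y lo+ε≤y (≤-respʳ-≈ (sym (+-assoc lo ε _)) y≤hi)
    ... | k , p = suc k , p

    module _ {f : I → ℝ} {lo hi : ℝ} (lo≤f : ∀ i → lo ≤ f i) (f≤hi : ∀ i → f i ≤ hi) where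

      simple-approx : ∀ ε → 0# < ε → ∃ λ s → (∀ i → at s i ≤ f i) × (∀ i → f i ≤ at s i + ε)
      simple-approx ε 0<ε with archimedean 0<ε (hi + - lo)
      ... | n , hi-lo≤nε = record { cell = proj₁ ∘ k ; coeff = grid ε lo }
                         , proj₁ ∘ proj₂ ∘ k , proj₂ ∘ proj₂ ∘ k
        where
        k : ∀ i → ∃ λ (j : Fin (suc n)) → grid ε lo j ≤ f i × f i ≤ grid ε lo j + ε
        k i = floor ε n lo (f i) (lo≤f i) (begin
          f i                ≤⟨ f≤hi i ⟩
          hi                 ≈⟨ x-y+y≈x hi lo ⟨
          hi + - lo + lo     ≤⟨ +-monoˡ-≤ lo hi-lo≤nε ⟩
          n · ε + lo         ≈⟨ +-comm _ lo ⟩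
          -- The extra cell is added because `floor` expects at least one, while `n` may be zero.
          lo + n · ε         ≤⟨ x≤x+ε _ (proj₁ 0<ε) ⟩
          lo + n · ε + ε     ≈⟨ solve 3 (λ l x e → l :+ x :+ e := l :+ (e :+ x)) refl lo (n · ε) ε ⟩
          lo + suc n · ε     ∎)

      -- The candidate is the supremum of the lower sums. Rounding `f` down to a grid and raising
      -- the result by `ε` gives a sandwich whose integrals differ by `ε`, so the upper sums come
      -- down to the same number.
      bounded⇒integrable : ∃ (IsIntegral μ f)
      bounded⇒integrable with complete (LowerSum μ f) (_ , constant lo , lo≤f , refl)
        (∫-simple μ (constant hi) , λ x (s , s≤f , p) →
          ≤-respˡ-≈ (sym p) (∫-simple-mono s (constant hi) (λ i → ≤-trans (s≤f i) (f≤hi i))))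
      ... | r , ub , least = r , approx⇒integral 0≤1 approx
        where
        approx : ∀ ε → 0# < ε → Approx f r (1# * ε)
        approx ε 0<ε with simple-approx ε 0<ε
        ... | s , s≤f , f≤s+ε = record
          { lower     = s
          ; upper     = t
          ; lower≤f   = s≤f
          ; f≤upper   = f≤t
          ; r≤lower+ε = least _ λ x (u , u≤f , x≈∫u) → begin
              x                       ≈⟨ x≈∫u ⟩
              ∫-simple μ u            ≤⟨ ∫-simple-mono u t (λ i → ≤-trans (u≤f i) (f≤t i)) ⟩
              ∫-simple μ t            ≈⟨ ∫t ⟩
              ∫-simple μ s + 1# * ε   ∎
          ; upper≤r+ε = begin
              ∫-simple μ t            ≈⟨ ∫t ⟩
              ∫-simple μ s + 1# * ε   ≤⟨ +-monoˡ-≤ _ (ub _ (s , s≤f , refl)) ⟩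
              r + 1# * ε              ∎
          }
          where
          t : Simple I
          t = s ⊞ constant ε

          f≤t : ∀ i → f i ≤ at t i
          f≤t i = ≤-respʳ-≈ (reflexive (≡.sym (at-⊞ s (constant ε) i))) (f≤s+ε i)

          ∫t : ∫-simple μ t ≈ ∫-simple μ s + 1# * ε
          ∫t = trans (∫-⊞ s (constant ε)) (+-congˡ (trans (∫-constant ε) (sym (*-identityˡ ε))))

      ∫-isIntegral : IsIntegral μ f (∫ μ f)
      ∫-isIntegral = integral-resp (λ _ → refl) (sym (∫-≈ isInt)) isInt
        where
        isInt : IsIntegral μ f _
        isInt = proj₂ bounded⇒integrable

    -- Exchanging the integral with suprema and infima.

    module _ {A : I → Set ℓ} {f : ∀ i → A i → ℝ} {g : (∀ i → A i) → ℝ}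
             (∫f : ∀ x → IsIntegral μ (λ i → f i (x i)) (g x)) {h : I → ℝ} {r : ℝ}
             (∫h : IsIntegral μ h r) where

      integral-sup : (∀ i → IsSupremum (range (f i)) (h i)) → IsSupremum (range g) r
      integral-sup isSup =
        (λ y (x , y≈gx) → ≤-respˡ-≈ (sym y≈gx)
          (integral-mono (λ i → proj₁ (isSup i) _ (x i , refl)) (∫f x) ∫h)) ,
        (λ u u≥ → ≤-by-ε λ ε 0<ε →
          -- `sup-approx` returns a witness at each index, so the family of near-optimal points is a
          -- projection of `best`.
          let best = λ i → sup-approx 0<ε (isSup i)
              x    = λ i → proj₁ (proj₁ (proj₂ (best i)))
          in begin
            r       ≤⟨ integral-mono (λ i → let _ , (_ , y≈fx) , h≤y+ε = best i in
                                            ≤-respʳ-≈ (+-congʳ y≈fx) h≤y+ε)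
                         ∫h (integral-+ (∫f x) (integral-constant ε)) ⟩
            g x + ε ≤⟨ +-monoˡ-≤ ε (u≥ _ (x , refl)) ⟩
            u + ε   ∎)

      integral-inf : (∀ i → IsInfimum (range (f i)) (h i)) → IsInfimum (range g) r
      integral-inf isInf =
        (λ y (x , y≈gx) → ≤-respʳ-≈ (sym y≈gx)
          (integral-mono (λ i → proj₁ (isInf i) _ (x i , refl)) ∫h (∫f x))) ,
        (λ l l≤ → ≤-by-ε λ ε 0<ε →
          let best = λ i → inf-approx 0<ε (isInf i)
              x    = λ i → proj₁ (proj₁ (proj₂ (best i)))
          in begin
            l       ≤⟨ l≤ _ (x , refl) ⟩
            g x     ≤⟨ integral-mono (λ i → let _ , (_ , y≈fx) , y≤h+ε = best i in
                                            ≤-respˡ-≈ y≈fx y≤h+ε)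
                         (∫f x) (integral-+ ∫h (integral-constant ε)) ⟩
            r + ε   ∎)

-- Values of affine formulas in the ultramean.

module Łoś {ℓ : Level} (em : ExcludedMiddle ℓ) (𝓡 : CompleteOrderedField ℓ) where

  open OrderedField 𝓡
  open AffineLogic em 𝓡
  open Integration em 𝓡

  module _ {L : Language} where

    open Structure using (raw; point; rel-nonNeg; rel-≤1)

    -- The bounds depend on `φ` alone; uniformity over structures is what makes the value at index
    -- `i` a bounded, hence integrable, function of `i`.
    value-bounded : ∀ {n} (φ : Formula L n) → ∃ λ lo → ∃ λ hi →
                    ∀ (M : Structure L) as → lo ≤ value (raw M) φ as × value (raw M) φ as ≤ hi
    value-bounded one         = 1# , 1# , λ M as → ≤-refl , ≤-refl
    value-bounded (atom R ts) = 0# , 1# , λ M as → rel-nonNeg M R _ , rel-≤1 M R _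
    value-bounded (φ ⊕ ψ) with value-bounded φ | value-bounded ψ
    ... | _ , _ , p | _ , _ , q = _ , _ , λ M as →
      +-mono-≤ (proj₁ (p M as)) (proj₁ (q M as)) , +-mono-≤ (proj₂ (p M as)) (proj₂ (q M as))
    value-bounded (r ⊙ φ) with value-bounded φ | total 0# r
    ... | _ , _ , p | inj₁ 0≤r = _ , _ , λ M as →
      *-monoˡ-≤ 0≤r (proj₁ (p M as)) , *-monoˡ-≤ 0≤r (proj₂ (p M as))
    ... | _ , _ , p | inj₂ r≤0 = _ , _ , λ M as →
      *-antiˡ-≤ r≤0 (proj₂ (p M as)) , *-antiˡ-≤ r≤0 (proj₁ (p M as))
    value-bounded (sup φ) with value-bounded φ
    ... | lo , hi , p = lo , hi , λ M as →
      let (ub , least) = ⨆-isSupremum (point M) (λ x → proj₂ (p M (x ∷ as))) in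
      ≤-trans (proj₁ (p M (point M ∷ as))) (ub _ (point M , refl)) ,
      least hi (λ y (x , y≈) → ≤-respˡ-≈ (sym y≈) (proj₂ (p M (x ∷ as))))
    value-bounded (inf φ) with value-bounded φ
    ... | lo , hi , p = lo , hi , λ M as →
      let (lb , greatest) = ⨅-isInfimum (point M) (λ x → proj₁ (p M (x ∷ as))) in
      greatest lo (λ y (x , y≈) → ≤-respʳ-≈ (sym y≈) (proj₁ (p M (x ∷ as)))) ,
      ≤-trans (lb _ (point M , refl)) (proj₂ (p M (point M ∷ as)))

    module _ {I : Set ℓ} (μ : Ultracharge I) (M : I → Structure L) where

      Family : ℕ → Set ℓ
      Family n = Vec (RawStructure.Carrier (ultramean μ M)) n

      mutual
        -- Constants and functions act componentwise on representing families, so the equality is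
        -- propositional and involves no integral.
        term-component : ∀ {n} (t : Term L n) (as : Family n) i →
          ⟦_⟧ᵗ (ultramean μ M) t as i ≡ ⟦_⟧ᵗ (raw (M i)) t (components i as)
        term-component (var x)    as i = ≡.sym (lookup-map x (λ a → a i) as)
        term-component (con c)    as i = ≡.refl
        term-component (app F ts) as i =
          ≡.cong (RawStructure.⟦fun⟧ (raw (M i)) F) (terms-components ts as i)

        terms-components : ∀ {n k} (ts : Vec (Term L n) k) (as : Family n) i →
          components i (⟦_⟧ᵗˢ (ultramean μ M) ts as) ≡ ⟦_⟧ᵗˢ (raw (M i)) ts (components i as)
        terms-components []       as i = ≡.refl
        terms-components (t ∷ ts) as i =
          ≡.cong₂ _∷_ (term-component t as i) (terms-components ts as i)

      value-isIntegrable : ∀ {n} (φ : Formula L n) (as : ∀ i → Vec (Structure.Carrier (M i)) n) →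
        IsIntegral μ (λ i → value (raw (M i)) φ (as i)) (∫ μ (λ i → value (raw (M i)) φ (as i)))
      value-isIntegrable φ as =
        let _ , _ , bounded = value-bounded φ
        in ∫-isIntegral μ (λ i → proj₁ (bounded (M i) (as i))) (λ i → proj₂ (bounded (M i) (as i)))

      -- The induction carries `IsIntegral` instead of an equation with `∫`, since integrability is
      -- what the linearity and exchange lemmas consume.
      value-isIntegral : ∀ {n} (φ : Formula L n) (as : Family n) →
        IsIntegral μ (λ i → value (raw (M i)) φ (components i as)) (value (ultramean μ M) φ as)
      value-isIntegral one         as = integral-constant μ 1#
      value-isIntegral (atom R ts) as =
        integral-resp μ (λ _ → refl) (sym (∫-≈ μ (integral-resp μ rel≈ refl isInt))) isInt
        where
        rel≈ = λ i → reflexive (≡.cong (RawStructure.⟦rel⟧ (raw (M i)) R)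
                                       (≡.sym (terms-components ts as i)))
        isInt = value-isIntegrable (atom R ts) (λ i → components i as)
      value-isIntegral (φ ⊕ ψ)     as = integral-+ μ (value-isIntegral φ as) (value-isIntegral ψ as)
      value-isIntegral (r ⊙ φ)     as = integral-* μ r (value-isIntegral φ as)
      value-isIntegral (sup φ)     as =
        integral-resp μ (λ _ → refl) (sym (⨆-≈ isSup)) isInt
        where
        isInt = value-isIntegrable (sup φ) (λ i → components i as)
        -- The induction hypothesis at `x ∷ as` fits because `components i (x ∷ as)` reduces to
        -- `x i ∷ components i as`.
        isSup = integral-sup μ (λ x → value-isIntegral φ (x ∷ as)) isInt λ i →
          let _ , _ , bounded = value-bounded φ
          in ⨆-isSupremum (point (M i)) (λ x → proj₂ (bounded (M i) _))
      value-isIntegral (inf φ)     as =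
        integral-resp μ (λ _ → refl) (sym (⨅-≈ isInf)) isInt
        where
        isInt = value-isIntegrable (inf φ) (λ i → components i as)
        isInf = integral-inf μ (λ x → value-isIntegral φ (x ∷ as)) isInt λ i →
          let _ , _ , bounded = value-bounded φ
          in ⨅-isInfimum (point (M i)) (λ x → proj₁ (bounded (M i) _))

mainTheorem1 :
    {ℓ : Level} (em : ExcludedMiddle ℓ) (𝓡 : CompleteOrderedField ℓ) →
    let open CompleteOrderedField 𝓡 using (_≈_)
        open AffineLogic em 𝓡
    in
    (L : Language) (I : Set ℓ) (i₀ : I) (μ : Ultracharge I)
    (M : I → Structure L) {n : ℕ} (φ : Formula L n)
    (a : Vec (RawStructure.Carrier (ultramean μ M)) n) →
    value (ultramean μ M) φ a
      ≈ ∫ μ (λ i → value (Structure.raw (M i)) φ (components i a))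
mainTheorem1 em 𝓡 L I i₀ μ M φ a =
  sym (∫-≈ μ (value-isIntegral μ M φ a))
  where
  open OrderedField 𝓡 using (sym)
  open Integration em 𝓡 using (∫-≈)
  open Łoś em 𝓡 using (value-isIntegral)
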